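{- There exist a $2$-$(1576,8,1)$ design and a $2$-$(2025,9,1)$ design.
   Context: A $2$-$(v,k,\lambda)$ design is a pair $(V,\mathcal{A})$ where $V$ is a set of $v$ points and $\mathcal{A}$ is a collection (multiset) of $k$-subsets of $V$ (blocks) such that every $2$-subset of $V$ is contained in exactly $\lambda$ blocks of $\mathcal{A}$. -}

module Defs where

open import Data.Nat using (ℕ)
open import Data.Fin using (Fin)
open import Data.Fin.Subset using (Subset; _∈_; ∣_∣)
open import Data.Fin.Subset.Properties using (_∈?_)
open import Data.List using (List; length; filter)
open import Data.List.Relation.Unary.All using (All)
open import Data.Product using (_×_)
open import Relation.Nullary using (¬_)
open import Relation.Nullary.Decidable using (_×-dec_)
open import Relation.Binary.PropositionalEquality using (_≡_)

blocksThrough : {v : ℕ} → List (Subset v) → Fin v → Fin v → ℕ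
blocksThrough 𝓐 x y = length (filter (λ B → (x ∈? B) ×-dec (y ∈? B)) 𝓐)

record Design2 (v k λ′ : ℕ) : Set where
  field
    blocks      : List (Subset v)
    blockSize   : All (λ B → ∣ B ∣ ≡ k) blocks
    balanced    : (x y : Fin v) → ¬ (x ≡ y) → blocksThrough blocks x y ≡ λ′

{-# OPTIONS --safe #-}
module Submission where

-- Both designs consist of the translates of a relative difference family over
-- H × 𝔽₂₅, with H = ℤ/63 or ℤ/81: every difference whose 𝔽₂₅-component is nonzero
-- arises exactly once from 27 base blocks, so two points in different cosets of
-- H × 0 lie in exactly one translate.  The cosets are then filled with copies of the
-- affine plane of order 8 (adding one point at infinity: 1 + 63 = 64) or 9 (81 points).
-- The 27 base blocks come from three starter blocks under σ (h , x) = (- h , τ x), where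
-- τ has order 12 in 𝔽₂₅*; the orbits have lengths 3, 12 and 12.  The
-- H-components of the starters, taken 1, 4 and 4 times, form a strong difference family.

open import Defs
open import Algebra.Bundles using (Group)
open import Algebra.Structures using (IsGroup)
import Algebra.Properties.Group as GroupProperties
open import Data.Bool using (true)
open import Data.Fin using (Fin; zero; suc; toℕ)
open import Data.Fin.Properties using (all?; +↔⊎; *↔×; toℕ-injective; toℕ-fromℕ<; toℕ<n)
import Data.Fin.Properties as Fin
open import Data.Fin.Subset using (Subset; inside; outside; _∈_; _∉_; ∣_∣; ⁅_⁆; _∪_; ⊥)
open import Data.Fin.Subset.Properties using (_∈?_; ∉⊥; ∣⊥∣≡0; x∈⁅x⁆; x∈⁅y⁆⇒x≡y; x∈p∪q⁺; x∈p∪q⁻; ∪-identityˡ)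
open import Data.List using (List; []; _∷_; length; filter; map; allFin; cartesianProduct)
open import Data.List.Membership.Propositional using () renaming (_∈_ to _∈ˡ_)
open import Data.List.Membership.Propositional.Properties using (∈-allFin; ∈-cartesianProduct⁺; ∈-filter⁺; ∈-filter⁻; ∈-map⁺; ∈-map⁻)
open import Data.List.Relation.Unary.All using ([]; _∷_; universal)
import Data.List.Relation.Unary.All.Properties as All
open import Data.List.Relation.Unary.Any using (here; there)
open import Data.List.Relation.Unary.Unique.Propositional using (Unique; []; _∷_)
import Data.List.Relation.Unary.Unique.Propositional.Properties as Unique
open import Data.Nat using (ℕ; zero; suc; _+_; _*_; _∸_; _%_; NonZero)
import Data.Nat as ℕ
open import Data.Nat.DivMod using (_mod_; m%n<n; %-distribˡ-+; m%n%n≡m%n; m<n⇒m%n≡m; n%n≡0)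
open import Data.Nat.Properties using (+-assoc; +-comm; +-identityʳ; m∸n+n≡m; <⇒≤)
open import Data.Product using (∃; _×_; _,_; proj₁; proj₂)
open import Data.Product.Function.NonDependent.Propositional using (_×-↔_)
open import Data.Product.Properties using (,-injective)
open import Data.Sum using (_⊎_; inj₁; inj₂)
import Data.Sum as Sum
open import Data.Sum.Function.Propositional using (_⊎-↔_)
open import Data.Sum.Properties using (inj₂-injective)
open import Data.Vec using (Vec; []; _∷_; _++_; lookup; iterate)
import Data.Vec as Vec
open import Function using (_∘_; _↔_; Inverse; Injection; Injective)
open import Function.Properties.Inverse using (↔-refl; ↔-sym; ↔-trans; ↔⇒↣)
open import Level using (0ℓ)
open import Relation.Binary.Definitions using (DecidableEquality)
open import Relation.Binary.PropositionalEquality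
open import Relation.Nullary using (¬_; Dec; yes; no; does; contradiction)
open import Relation.Nullary.Decidable using (_×-dec_; _⊎-dec_; _→-dec_; map′)
open import Relation.Unary using (Decidable)

open Inverse using (to; from; strictlyInverseˡ; strictlyInverseʳ)

-- Enumerated types and decidable quantification over them.

Finite : ℕ → Set → Set
Finite n A = A ↔ Fin n

to-injective : {A B : Set} (A↔B : A ↔ B) → Injective _≡_ _≡_ (to A↔B)
to-injective A↔B = Injection.injective (↔⇒↣ A↔B)

module _ {n A} (enum : Finite n A) where

  finite-≟ : DecidableEquality A
  finite-≟ x y = map′ (to-injective enum) (cong (to enum)) (to enum x Fin.≟ to enum y)

  finite-all? : {P : A → Set} → Decidable P → Dec (∀ x → P x)
  finite-all? {P} P? = map′
    (λ f x → subst P (strictlyInverseʳ enum x) (f (to enum x)))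
    (λ f i → f (from enum i))
    (all? (λ i → P? (from enum i)))

finite-× : ∀ {m n A B} → Finite m A → Finite n B → Finite (m * n) (A × B)
finite-× p q = ↔-trans (p ×-↔ q) (↔-sym *↔×)

finite-⊎ : ∀ {m n A B} → Finite m A → Finite n B → Finite (m + n) (A ⊎ B)
finite-⊎ p q = ↔-trans (p ⊎-↔ q) (↔-sym +↔⊎)

-- Blocks as images of injections, and lists of length one.

range : ∀ {k v} → (Fin k → Fin v) → Subset v
range {zero}  f = ⊥
range {suc k} f = ⁅ f zero ⁆ ∪ range (f ∘ suc)

∈-range⁺ : ∀ {k v} (f : Fin k → Fin v) i → f i ∈ range f
∈-range⁺ f zero    = x∈p∪q⁺ (inj₁ (x∈⁅x⁆ (f zero)))
∈-range⁺ f (suc i) = x∈p∪q⁺ (inj₂ (∈-range⁺ (f ∘ suc) i))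

∈-range⁻ : ∀ {k v} (f : Fin k → Fin v) {x} → x ∈ range f → ∃ λ i → f i ≡ x
∈-range⁻ {zero}  f x∈ = contradiction x∈ ∉⊥
∈-range⁻ {suc k} f x∈ with x∈p∪q⁻ ⁅ f zero ⁆ (range (f ∘ suc)) x∈
... | inj₁ x∈₁ = zero , sym (x∈⁅y⁆⇒x≡y (f zero) x∈₁)
... | inj₂ x∈₂ with i , eq ← ∈-range⁻ (f ∘ suc) x∈₂ = suc i , eq

∣⁅x⁆∪p∣ : ∀ {v} (x : Fin v) (p : Subset v) → x ∉ p → ∣ ⁅ x ⁆ ∪ p ∣ ≡ suc ∣ p ∣
∣⁅x⁆∪p∣ zero    (inside  ∷ p) x∉p = contradiction Vec.here x∉p
∣⁅x⁆∪p∣ zero    (outside ∷ p) x∉p = cong (suc ∘ ∣_∣) (∪-identityˡ p)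
∣⁅x⁆∪p∣ (suc x) (inside  ∷ p) x∉p = cong suc (∣⁅x⁆∪p∣ x p (x∉p ∘ Vec.there))
∣⁅x⁆∪p∣ (suc x) (outside ∷ p) x∉p = ∣⁅x⁆∪p∣ x p (x∉p ∘ Vec.there)

∣range∣ : ∀ {k v} (f : Fin k → Fin v) → Injective _≡_ _≡_ f → ∣ range f ∣ ≡ k
∣range∣ {zero}  {v} f inj = ∣⊥∣≡0 v
∣range∣ {suc k} f inj = trans
  (∣⁅x⁆∪p∣ (f zero) (range (f ∘ suc)) fresh)
  (cong suc (∣range∣ (f ∘ suc) (Fin.suc-injective ∘ inj)))
  where
  fresh : f zero ∉ range (f ∘ suc)
  fresh f0∈ with ∈-range⁻ (f ∘ suc) f0∈
  ... | i , eq with () ← inj eq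

length-filter-map : {A B : Set} {P : B → Set} (P? : Decidable P) (f : A → B) (xs : List A) →
                    length (filter P? (map f xs)) ≡ length (filter (λ x → P? (f x)) xs)
length-filter-map P? f []       = refl
length-filter-map P? f (x ∷ xs) with P? (f x)
... | yes _ = cong suc (length-filter-map P? f xs)
... | no  _ = length-filter-map P? f xs

-- Bridge between counting and unique existence: this direction yields λ = 1 for designs, and the
-- next two lemmas read cells off a difference count.
length≡1 : {A : Set} {x : A} {xs : List A} → Unique xs → x ∈ˡ xs →
           (∀ {y} → y ∈ˡ xs → y ≡ x) → length xs ≡ 1
length≡1 {xs = _ ∷ []}    _               _ _    = refl
length≡1 {xs = _ ∷ _ ∷ _} ((y≢z ∷ _) ∷ _) _ only =
  contradiction (trans (only (here refl)) (sym (only (there (here refl))))) y≢z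

length≡1⇒unique : {A : Set} {x y : A} {xs : List A} → length xs ≡ 1 → x ∈ˡ xs → y ∈ˡ xs → x ≡ y
length≡1⇒unique {xs = _ ∷ []} _ (here refl) (here refl) = refl

length≡1⇒inhabited : {A : Set} {xs : List A} → length xs ≡ 1 → ∃ (_∈ˡ xs)
length≡1⇒inhabited {xs = x ∷ _} _ = x , here refl

-- Linear spaces with constant line size, and their designs.

record LinearSpace (P : Set) (k : ℕ) : Set₁ where
  field
    Line            : Set
    {size}          : ℕ
    finite          : Finite size Line
    point           : Line → Fin k → P
    point-injective : ∀ l → Injective _≡_ _≡_ (point l)

  infix 4 _on_
  _on_ : P → Line → Set
  x on l = ∃ λ i → point l i ≡ x

  field
    join        : ∀ {x y} → x ≢ y → ∃ λ l → x on l × y on l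
    join-unique : ∀ {x y l m} → x ≢ y → x on l → y on l → x on m → y on m → l ≡ m

transport : ∀ {P Q k} → P ↔ Q → LinearSpace P k → LinearSpace Q k
transport {P} {Q} P↔Q S = record
  { Line            = Line
  ; finite          = finite
  ; point           = λ l → to P↔Q ∘ point l
  ; point-injective = λ l → point-injective l ∘ to-injective P↔Q
  ; join            = λ {x} {y} x≢y → let l , x∈l , y∈l = join (x≢y ∘ from-inj) in l , push x∈l , push y∈l
  ; join-unique     = λ x≢y x∈l y∈l x∈m y∈m →
                        join-unique (x≢y ∘ from-inj) (pull x∈l) (pull y∈l) (pull x∈m) (pull y∈m)
  }
  where
  open LinearSpace S
  from-inj : Injective _≡_ _≡_ (from P↔Q)
  from-inj = to-injective (↔-sym P↔Q)
  push : ∀ {x l} → from P↔Q x on l → ∃ λ i → to P↔Q (point l i) ≡ x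
  push (i , eq) = i , trans (cong (to P↔Q) eq) (strictlyInverseˡ P↔Q _)
  pull : ∀ {x l} → (∃ λ i → to P↔Q (point l i) ≡ x) → from P↔Q x on l
  pull (i , eq) = i , trans (sym (strictlyInverseʳ P↔Q _)) (cong (from P↔Q) eq)

-- The injective parametrisation of lines by `Fin k` gives the block size; `join` and `join-unique`
-- together give the count 1.
toDesign : ∀ {v k} → LinearSpace (Fin v) k → Design2 v k 1
toDesign {v} S = record
  { blocks    = map block (allFin size)
  ; blockSize = All.map⁺ (universal (λ i → ∣range∣ _ (point-injective (from finite i))) _)
  ; balanced  = λ x y x≢y → trans
      -- The count is moved from blocks to line indices, which are distinct by construction.
      (length-filter-map (λ B → (x ∈? B) ×-dec (y ∈? B)) block (allFin size))
      (balanced x y x≢y)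
  }
  where
  open LinearSpace S

  block : Fin size → Subset v
  block i = range (point (from finite i))

  balanced : ∀ x y → ¬ x ≡ y →
             length (filter (λ i → (x ∈? block i) ×-dec (y ∈? block i)) (allFin size)) ≡ 1
  balanced x y x≢y = length≡1 (Unique.filter⁺ _ (Unique.allFin⁺ size)) l∈ only
    where
    through? = λ i → (x ∈? block i) ×-dec (y ∈? block i)
    on⇒∈ : ∀ {z l} → z on l → z ∈ block (to finite l)
    on⇒∈ {l = l} (i , refl) rewrite strictlyInverseʳ finite l = ∈-range⁺ (point l) i
    xy = join x≢y
    l∈ : to finite (proj₁ xy) ∈ˡ filter through? (allFin size)
    l∈ = ∈-filter⁺ through? (∈-allFin _) (on⇒∈ (proj₁ (proj₂ xy)) , on⇒∈ (proj₂ (proj₂ xy)))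
    only : ∀ {i} → i ∈ˡ filter through? (allFin size) → i ≡ to finite (proj₁ xy)
    only {i} i∈ with _ , (x∈ , y∈) ← ∈-filter⁻ through? {xs = allFin size} i∈ =
      trans (sym (strictlyInverseˡ finite i)) (cong (to finite)
        (join-unique x≢y (∈-range⁻ _ x∈) (∈-range⁻ _ y∈) (proj₁ (proj₂ xy)) (proj₂ (proj₂ xy))))

-- Finite groups: cyclic groups and direct products.

record FiniteGroup : Set₁ where
  infix  8 _⁻¹
  infixl 7 _∙_
  infix  4 _≟_
  field
    Carrier : Set
    {order} : ℕ
    finite  : Finite order Carrier
    _∙_     : Carrier → Carrier → Carrier
    ε       : Carrier
    _⁻¹     : Carrier → Carrier
    isGroup : IsGroup _≡_ _∙_ ε _⁻¹

  group : Group 0ℓ 0ℓ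
  group = record { isGroup = isGroup }

  open IsGroup isGroup public using (_//_; assoc; identityˡ; identityʳ; inverseˡ; inverseʳ)
  open GroupProperties group public

  _≟_ : DecidableEquality Carrier
  _≟_ = finite-≟ finite

module _ (n : ℕ) .{{_ : NonZero n}} where

  private
    infixl 6 _⊕_
    _⊕_ : Fin n → Fin n → Fin n
    x ⊕ y = (toℕ x + toℕ y) mod n

    ⊖_ : Fin n → Fin n
    -- The reduction matters at 0, where the difference is `n` itself.
    ⊖ x = (n ∸ toℕ x) mod n

    toℕ-mod : ∀ a → toℕ (a mod n) ≡ a % n
    toℕ-mod a = toℕ-fromℕ< (m%n<n a n)

    mod-toℕ : ∀ x → toℕ x mod n ≡ x
    mod-toℕ x = toℕ-injective (trans (toℕ-mod (toℕ x)) (m<n⇒m%n≡m (toℕ<n x)))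

    mod-cong : ∀ {a b} → a % n ≡ b % n → a mod n ≡ b mod n
    mod-cong {a} {b} eq = toℕ-injective (trans (toℕ-mod a) (trans eq (sym (toℕ-mod b))))

    %-absorbʳ : ∀ a b → (a + b % n) % n ≡ (a + b) % n
    %-absorbʳ a b = begin
      (a + b % n) % n          ≡⟨ %-distribˡ-+ a (b % n) n ⟩
      (a % n + b % n % n) % n  ≡⟨ cong (λ c → (a % n + c) % n) (m%n%n≡m%n b n) ⟩
      (a % n + b % n) % n      ≡⟨ %-distribˡ-+ a b n ⟨
      (a + b) % n              ∎
      where open ≡-Reasoning

    ⊕-mod : ∀ x b → x ⊕ (b mod n) ≡ (toℕ x + b) mod n
    ⊕-mod x b = mod-cong (trans (cong (λ c → (toℕ x + c) % n) (toℕ-mod b)) (%-absorbʳ (toℕ x) b))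

    ⊕-comm : ∀ x y → x ⊕ y ≡ y ⊕ x
    ⊕-comm x y = cong (_mod n) (+-comm (toℕ x) (toℕ y))

    ⊕-assoc : ∀ x y z → (x ⊕ y) ⊕ z ≡ x ⊕ (y ⊕ z)
    ⊕-assoc x y z = begin
      (x ⊕ y) ⊕ z                      ≡⟨ ⊕-comm (x ⊕ y) z ⟩
      z ⊕ (x ⊕ y)                      ≡⟨ ⊕-mod z (toℕ x + toℕ y) ⟩
      (toℕ z + (toℕ x + toℕ y)) mod n  ≡⟨ cong (_mod n) (+-comm (toℕ z) _) ⟩
      (toℕ x + toℕ y + toℕ z) mod n    ≡⟨ cong (_mod n) (+-assoc (toℕ x) (toℕ y) (toℕ z)) ⟩
      (toℕ x + (toℕ y + toℕ z)) mod n  ≡⟨ ⊕-mod x (toℕ y + toℕ z) ⟨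
      x ⊕ (y ⊕ z)                      ∎
      where open ≡-Reasoning

    ⊕-identityʳ : ∀ x → x ⊕ (0 mod n) ≡ x
    ⊕-identityʳ x = trans (⊕-mod x 0) (trans (cong (_mod n) (+-identityʳ (toℕ x))) (mod-toℕ x))

    ⊕-inverseˡ : ∀ x → ⊖ x ⊕ x ≡ 0 mod n
    ⊕-inverseˡ x = begin
      ⊖ x ⊕ x                      ≡⟨ ⊕-comm (⊖ x) x ⟩
      x ⊕ ⊖ x                      ≡⟨ ⊕-mod x (n ∸ toℕ x) ⟩
      (toℕ x + (n ∸ toℕ x)) mod n  ≡⟨ cong (_mod n) (trans (+-comm (toℕ x) _) (m∸n+n≡m (<⇒≤ (toℕ<n x)))) ⟩
      n mod n                      ≡⟨ mod-cong (trans (n%n≡0 n) (sym (m<n⇒m%n≡m (ℕ.>-nonZero⁻¹ n)))) ⟩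
      0 mod n                      ∎
      where open ≡-Reasoning

  ℤ/_ : FiniteGroup
  ℤ/_ = record
    { finite  = ↔-refl
    ; _∙_     = _⊕_
    ; ε       = 0 mod n
    ; _⁻¹     = ⊖_
    ; isGroup = record
      { isMonoid = record
        { isSemigroup = record
          { isMagma = record { isEquivalence = isEquivalence ; ∙-cong = cong₂ _⊕_ }
          ; assoc   = ⊕-assoc
          }
        ; identity = (λ x → trans (⊕-comm (0 mod n) x) (⊕-identityʳ x)) , ⊕-identityʳ
        }
      ; inverse = ⊕-inverseˡ , (λ x → trans (⊕-comm x (⊖ x)) (⊕-inverseˡ x))
      ; ⁻¹-cong = cong ⊖_
      }
    }

infixr 2 _×ᴳ_
_×ᴳ_ : FiniteGroup → FiniteGroup → FiniteGroup
G ×ᴳ H = record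
  { finite  = finite-× G.finite H.finite
  ; _∙_     = λ (x , y) (x′ , y′) → x G.∙ x′ , y H.∙ y′
  ; ε       = G.ε , H.ε
  ; _⁻¹     = λ (x , y) → x G.⁻¹ , y H.⁻¹
  ; isGroup = record
    { isMonoid = record
      { isSemigroup = record
        { isMagma = record { isEquivalence = isEquivalence ; ∙-cong = cong₂ _ }
        ; assoc   = λ _ _ _ → cong₂ _,_ (G.assoc _ _ _) (H.assoc _ _ _)
        }
      ; identity = (λ _ → cong₂ _,_ (G.identityˡ _) (H.identityˡ _))
                 , (λ _ → cong₂ _,_ (G.identityʳ _) (H.identityʳ _))
      }
    ; inverse = (λ _ → cong₂ _,_ (G.inverseˡ _) (H.inverseˡ _))
              , (λ _ → cong₂ _,_ (G.inverseʳ _) (H.inverseʳ _))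
    ; ⁻¹-cong = λ { refl → refl }
    }
  }
  where
  module G = FiniteGroup G
  module H = FiniteGroup H

-- The factors `t` and `t ⁻¹` meet in the middle and cancel. Commutativity is not assumed, so
-- translations act on the right to match right quotients.
translate-// : (G : FiniteGroup) → let open FiniteGroup G in
               ∀ x y t → (x ∙ t) // (y ∙ t) ≡ x // y
translate-// G x y t = begin
  (x ∙ t) ∙ (y ∙ t) ⁻¹       ≡⟨ cong ((x ∙ t) ∙_) (⁻¹-anti-homo-∙ y t) ⟩
  (x ∙ t) ∙ (t ⁻¹ ∙ y ⁻¹)    ≡⟨ assoc x t _ ⟩
  x ∙ (t ∙ (t ⁻¹ ∙ y ⁻¹))    ≡⟨ cong (x ∙_) (\\-leftDividesˡ t (y ⁻¹)) ⟩
  x ∙ y ⁻¹                   ∎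
  where
  open FiniteGroup G
  open ≡-Reasoning

-- Affine planes over a division structure.

-- What is left of the axioms of a division ring once only the slopes of affine lines
-- have to be computed; x / y is unconstrained for y = ε.
record Division (G : FiniteGroup) : Set where
  open FiniteGroup G
  infixl 7 _·_ _/_
  field
    _·_       : Carrier → Carrier → Carrier
    _/_       : Carrier → Carrier → Carrier
    ·-distrib : ∀ m x y → m · (x // y) ≡ (m · x) // (m · y)
    /-·       : ∀ y x → x ≡ ε ⊎ y / x · x ≡ y
    ·-/       : ∀ m x → x ≡ ε ⊎ m · x / x ≡ m

module AffinePlane (G : FiniteGroup) (D : Division G) where
  open FiniteGroup G
  open Division D

  slope : Carrier × Carrier → Carrier × Carrier → Carrier
  slope (x , y) (x′ , y′) = (y′ // y) / (x′ // x)

  private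
    ≢⇒//≢ε : ∀ {x x′} → x ≢ x′ → x′ // x ≢ ε
    ≢⇒//≢ε x≢x′ eq = x≢x′ (sym (x∙y⁻¹≈ε⇒x≈y _ _ eq))

    -- The intercept makes the line pass through (x , y). It also reaches the second point because m
    -- x′ - m x = m (x′ - x) = y′ - y.
    line-through : ∀ {x y x′ y′} → x ≢ x′ → let m = slope (x , y) (x′ , y′) in
                   (m · x′) ∙ ((m · x) ⁻¹ ∙ y) ≡ y′
    line-through {x} {y} {x′} {y′} x≢x′ with /-· (y′ // y) (x′ // x)
    ... | inj₁ eq = contradiction eq (≢⇒//≢ε x≢x′)
    ... | inj₂ eq = begin
      (m · x′) ∙ ((m · x) ⁻¹ ∙ y)  ≡⟨ assoc _ _ _ ⟨
      ((m · x′) // (m · x)) ∙ y    ≡⟨ cong (_∙ y) (·-distrib m x′ x) ⟨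
      (m · (x′ // x)) ∙ y          ≡⟨ cong (_∙ y) eq ⟩
      (y′ // y) ∙ y                ≡⟨ //-rightDividesˡ y y′ ⟩
      y′                           ∎
      where
      open ≡-Reasoning
      m = slope (x , y) (x′ , y′)

    -- The intercept cancels in the difference of ordinates. Hence two points of a non-vertical line
    -- determine its slope, the key to uniqueness of lines.
    slope-line : ∀ {x x′} m b → x ≢ x′ → slope (x , (m · x) ∙ b) (x′ , (m · x′) ∙ b) ≡ m
    slope-line {x} {x′} m b x≢x′ with ·-/ m (x′ // x)
    ... | inj₁ eq = contradiction eq (≢⇒//≢ε x≢x′)
    ... | inj₂ eq = begin
      (((m · x′) ∙ b) // ((m · x) ∙ b)) / (x′ // x)  ≡⟨ cong (_/ (x′ // x)) (translate-// G _ _ b) ⟩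
      ((m · x′) // (m · x)) / (x′ // x)              ≡⟨ cong (_/ (x′ // x)) (·-distrib m x′ x) ⟨
      m · (x′ // x) / (x′ // x)                      ≡⟨ eq ⟩
      m                                              ∎
      where open ≡-Reasoning

  Line : Set
  Line = (Carrier × Carrier) ⊎ Carrier

  private
    point′ : Line → Carrier → Carrier × Carrier
    point′ (inj₁ (m , b)) x = x , (m · x) ∙ b
    point′ (inj₂ c)       y = c , y

    point′-injective : ∀ l → Injective _≡_ _≡_ (point′ l)
    point′-injective (inj₁ _) eq = proj₁ (,-injective eq)
    point′-injective (inj₂ _) eq = proj₂ (,-injective eq)

    join′ : ∀ {p q} → p ≢ q → ∃ λ l → (∃ λ z → point′ l z ≡ p) × (∃ λ z → point′ l z ≡ q)
    join′ {x , y} {x′ , y′} p≢q with x ≟ x′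
    ... | yes refl = inj₂ x , (y , refl) , (y′ , refl)
    ... | no x≢x′  = inj₁ (m , (m · x) ⁻¹ ∙ y)
                   , (x , cong (x ,_) (\\-leftDividesˡ (m · x) y))
                   , (x′ , cong (x′ ,_) (line-through x≢x′))
      where m = slope (x , y) (x′ , y′)

    join′-unique : ∀ l l′ {z₁ z₂ z₁′ z₂′} → z₁ ≢ z₂ →
                   point′ l z₁ ≡ point′ l′ z₁′ → point′ l z₂ ≡ point′ l′ z₂′ → l ≡ l′
    join′-unique (inj₁ (m , b)) (inj₁ (m′ , b′)) {z₁} {z₂} z₁≢z₂ eq₁ eq₂
      with refl , e₁ ← ,-injective eq₁ | refl , e₂ ← ,-injective eq₂
      with refl ← trans (sym (slope-line m b z₁≢z₂))
                    (trans (cong₂ (λ y y′ → slope (z₁ , y) (z₂ , y′)) e₁ e₂) (slope-line m′ b′ z₁≢z₂))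
      = cong (λ b → inj₁ (m , b)) (∙-cancelˡ _ _ _ e₁)
    join′-unique (inj₁ _) (inj₂ c) z₁≢z₂ eq₁ eq₂ =
      contradiction (trans (proj₁ (,-injective eq₁)) (sym (proj₁ (,-injective eq₂)))) z₁≢z₂
    join′-unique (inj₂ c) (inj₁ _) z₁≢z₂ eq₁ eq₂
      with refl , e₁ ← ,-injective eq₁ | refl , e₂ ← ,-injective eq₂ =
      contradiction (trans e₁ (sym e₂)) z₁≢z₂
    join′-unique (inj₂ c) (inj₂ c′) _ eq₁ _ = cong inj₂ (proj₁ (,-injective eq₁))

  affinePlane : LinearSpace (Carrier × Carrier) order
  affinePlane = record
    { Line            = Line
    ; finite          = finite-⊎ (finite-× finite finite) finite
    ; point           = λ l i → point′ l (from finite i)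
    ; point-injective = λ l → to-injective (↔-sym finite) ∘ point′-injective l
    ; join            = λ p≢q → let l , p∈ , q∈ = join′ p≢q in l , index p∈ , index q∈
    -- Matching the incidences with `l` by `refl` turns distinct points into distinct parameters on
    -- `l`.
    ; join-unique     = λ { {l = l} {m = m} p≢q (_ , refl) (_ , refl) (_ , eq₁) (_ , eq₂) →
                            join′-unique l m (p≢q ∘ cong (point′ l)) (sym eq₁) (sym eq₂) }
    }
    where
    index : ∀ {l p} → (∃ λ z → point′ l z ≡ p) → ∃ λ i → point′ l (from finite i) ≡ p
    index {l} (z , eq) = to finite z , trans (cong (point′ l) (strictlyInverseʳ finite z)) eq

-- Relative difference families and their decision procedure.

module RelativeDifferenceFamily (H K : FiniteGroup) where
  private
    module H = FiniteGroup H
    module K = FiniteGroup K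
    module G = FiniteGroup (H ×ᴳ K)

  module _ {s k : ℕ} (base : Fin s → Fin k → G.Carrier) where

    Cell : Set
    Cell = Fin s × Fin k × Fin k

    difference : Cell → G.Carrier
    difference (c , i , j) = base c i G.// base c j

    -- Group elements are compared through these numbers because Agda decides
    -- equality of numerals in one step.
    codeᴴ : H.Carrier → ℕ
    codeᴴ = toℕ ∘ to H.finite

    codeᴷ : K.Carrier → ℕ
    codeᴷ = toℕ ∘ to K.finite

    -- The cell is stored beside the codes so that a count of one identifies the cell, not merely
    -- the value of its difference.
    Entry : Set
    Entry = Cell × ℕ × ℕ

    entry : Cell → Entry
    entry p = p , codeᴴ (proj₁ (difference p)) , codeᴷ (proj₂ (difference p))

    entries : List Entry
    entries = map entry (cartesianProduct (allFin s) (cartesianProduct (allFin k) (allFin k)))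

    -- Filtering in two stages keeps evaluation cheap: the long list is filtered by H-component
    -- first, and only a short row is searched for each element of `K`.
    row : List Entry → ℕ → List Entry
    row δ a = filter (λ (_ , a′ , _) → a′ ℕ.≟ a) δ

    column : List Entry → ℕ → List Entry
    column δ b = filter (λ (_ , _ , b′) → b′ ℕ.≟ b) δ

    -- For a transversal family the exempt column `K.ε` holds exactly the diagonal cells
    -- `(c , i , i)`.
    OneInColumn : List Entry → Set
    OneInColumn ρ = ∀ y → y ≡ K.ε ⊎ length (column ρ (codeᴷ y)) ≡ 1

    -- `transversal` makes every translate meet each coset of H × 0 at most once, so translates
    -- share no pair of points with the lines that fill the cosets.
    record IsDifferenceFamily : Set where
      field
        transversal : ∀ c i j → proj₂ (base c i) ≡ proj₂ (base c j) → i ≡ j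
        balanced    : ∀ x → OneInColumn (row entries (codeᴴ x))

    transversal? : Dec (∀ c i j → proj₂ (base c i) ≡ proj₂ (base c j) → i ≡ j)
    transversal? = all? λ c → all? λ i → all? λ j →
      (proj₂ (base c i) K.≟ proj₂ (base c j)) →-dec (i Fin.≟ j)

    oneInColumn? : ∀ ρ → Dec (OneInColumn ρ)
    oneInColumn? ρ = finite-all? K.finite λ y → (y K.≟ K.ε) ⊎-dec (length (column ρ (codeᴷ y)) ℕ.≟ 1)

    -- The entries are an argument so that they are evaluated only once.
    balanced? : ∀ δ → Dec (∀ x → OneInColumn (row δ (codeᴴ x)))
    balanced? δ = finite-all? H.finite λ x → oneInColumn? (row δ (codeᴴ x))

    isDifferenceFamily? : Dec IsDifferenceFamily
    isDifferenceFamily? = map′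
      (λ (t , b) → record { transversal = t ; balanced = b })
      (λ d → IsDifferenceFamily.transversal d , IsDifferenceFamily.balanced d)
      (transversal? ×-dec balanced? entries)

  -- Development of a difference family with filled cosets.

  module Development {s k w : ℕ} (base : Fin s → Fin k → G.Carrier) (isDF : IsDifferenceFamily base)
                     {W : Set} (W-finite : Finite w W) (W-prop : (a b : W) → a ≡ b)
                     (S : LinearSpace (W ⊎ H.Carrier) k) where
    open IsDifferenceFamily isDF
    private module S = LinearSpace S

    private
      code-injective : ∀ {n A} (fin : Finite n A) {x y : A} →
                       toℕ (to fin x) ≡ toℕ (to fin y) → x ≡ y
      code-injective fin = to-injective fin ∘ toℕ-injective

      entry∈ : ∀ {x y} p → difference base p ≡ (x , y) →
               entry base p ∈ˡ column base (row base (entries base) (codeᴴ base x)) (codeᴷ base y)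
      entry∈ (c , i , j) refl = ∈-filter⁺ _ (∈-filter⁺ _ (∈-map⁺ (entry base)
        (∈-cartesianProduct⁺ (∈-allFin c) (∈-cartesianProduct⁺ (∈-allFin i) (∈-allFin j)))) refl) refl

      cover : ∀ x y → y ≢ K.ε → ∃ λ p → difference base p ≡ (x , y)
      cover x y y≢ε with balanced x y
      ... | inj₁ y≡ε = contradiction y≡ε y≢ε
      ... | inj₂ one
        with e , e∈ ← length≡1⇒inhabited one
        with e∈row , eqʸ ← ∈-filter⁻ (λ (_ , _ , b) → b ℕ.≟ codeᴷ base y)
                             {xs = row base (entries base) (codeᴴ base x)} e∈
        with e∈entries , eqˣ ← ∈-filter⁻ (λ (_ , a , _) → a ℕ.≟ codeᴴ base x)
                                 {xs = entries base} e∈row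
        with p , _ , refl ← ∈-map⁻ (entry base) e∈entries
        = p , cong₂ _,_ (code-injective H.finite eqˣ) (code-injective K.finite eqʸ)

      unique : ∀ p q {d} → proj₂ d ≢ K.ε → difference base p ≡ d → difference base q ≡ d → p ≡ q
      unique p q {x , y} y≢ε eqᵖ eqᵠ with balanced x y
      ... | inj₁ y≡ε = contradiction y≡ε y≢ε
      ... | inj₂ one = cong proj₁ (length≡1⇒unique one (entry∈ p eqᵖ) (entry∈ q eqᵠ))

    -- `W` holds the points at infinity, common to all fibres. `W-prop` admits at most one, since
    -- two of them would be joined once in every fibre.
    Point : Set
    Point = W ⊎ G.Carrier

    fibre : K.Carrier → W ⊎ H.Carrier → Point
    fibre y = Sum.map₂ (_, y)

    fibre-injective : ∀ y → Injective _≡_ _≡_ (fibre y)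
    fibre-injective y {inj₁ _} {inj₁ _} refl = refl
    fibre-injective y {inj₂ _} {inj₂ _} refl = refl

    Line : Set
    Line = (Fin s × G.Carrier) ⊎ (S.Line × K.Carrier)

    point : Line → Fin k → Point
    point (inj₁ (c , t)) i = inj₂ (base c i G.∙ t)
    point (inj₂ (l , y)) i = fibre y (S.point l i)

    private
      same-component : ∀ c t {i j} → proj₂ (base c i G.∙ t) ≡ proj₂ (base c j G.∙ t) → i ≡ j
      same-component c t eq = transversal c _ _ (K.∙-cancelʳ _ _ _ eq)

      point-injective : ∀ l → Injective _≡_ _≡_ (point l)
      point-injective (inj₁ (c , t)) eq = same-component c t (cong proj₂ (inj₂-injective eq))
      point-injective (inj₂ (l , y)) eq = S.point-injective l (fibre-injective y eq)

      infix 4 _on_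
      _on_ : Point → Line → Set
      p on l = ∃ λ i → point l i ≡ p

      join-in-fibre : ∀ y {p q} → p ≢ q → ∃ λ l → fibre y p on l × fibre y q on l
      join-in-fibre y p≢q with l , (i , refl) , (j , refl) ← S.join p≢q =
        inj₂ (l , y) , (i , refl) , (j , refl)

      join : ∀ {p q} → p ≢ q → ∃ λ l → p on l × q on l
      join {inj₁ a} {inj₁ b} p≢q = contradiction (cong inj₁ (W-prop a b)) p≢q
      join {inj₁ a} {inj₂ (x , y)} p≢q = join-in-fibre y {inj₁ a} {inj₂ x} λ ()
      join {inj₂ (x , y)} {inj₁ b} p≢q = join-in-fibre y {inj₂ x} {inj₁ b} λ ()
      join {inj₂ g@(x , y)} {inj₂ g′@(x′ , y′)} p≢q with y K.≟ y′
      ... | yes refl = join-in-fibre y {inj₂ x} {inj₂ x′} (p≢q ∘ cong (fibre y))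
      ... | no y≢y′
        with (c , i , j) , eq ← cover (x H.// x′) (y K.// y′) (y≢y′ ∘ K.x∙y⁻¹≈ε⇒x≈y y y′)
        = inj₁ (c , t) , (i , cong inj₂ bᵢt≡g) , (j , cong inj₂ bⱼt≡g′)
        where
        open ≡-Reasoning
        t : G.Carrier
        -- The only translation taking `base c i` to `g`; equality of the quotients then forces
        -- `base c j` onto `g′`.
        t = base c i G.⁻¹ G.∙ g
        bᵢt≡g : base c i G.∙ t ≡ g
        bᵢt≡g = G.\\-leftDividesˡ (base c i) g
        bⱼt≡g′ : base c j G.∙ t ≡ g′
        bⱼt≡g′ = sym (G.⁻¹-injective (G.∙-cancelˡ g _ _ (begin
          g G.// g′                                      ≡⟨ eq ⟨
          base c i G.// base c j                         ≡⟨ translate-// (H ×ᴳ K) _ _ t ⟨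
          (base c i G.∙ t) G.// (base c j G.∙ t)         ≡⟨ cong (G._// (base c j G.∙ t)) bᵢt≡g ⟩
          g G.// (base c j G.∙ t)                        ∎)))

      same-difference : ∀ {c c′ t t′ i j i′ j′} →
                        base c i G.∙ t ≡ base c′ i′ G.∙ t′ → base c j G.∙ t ≡ base c′ j′ G.∙ t′ →
                        base c′ i′ G.// base c′ j′ ≡ base c i G.// base c j
      same-difference {c} {c′} {t} {t′} {i} {j} {i′} {j′} eqᵢ eqⱼ = begin
        base c′ i′ G.// base c′ j′                    ≡⟨ translate-// (H ×ᴳ K) _ _ t′ ⟨
        (base c′ i′ G.∙ t′) G.// (base c′ j′ G.∙ t′)  ≡⟨ cong₂ G._//_ eqᵢ eqⱼ ⟨
        (base c i G.∙ t) G.// (base c j G.∙ t)        ≡⟨ translate-// (H ×ᴳ K) _ _ t ⟩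
        base c i G.// base c j                        ∎
        where open ≡-Reasoning

      -- Two common points give both cells the same difference, whose K-component is not `K.ε` by
      -- `transversal`. So `unique` identifies the cells, and cancellation identifies the
      -- translations.
      translates-unique : ∀ {c c′ t t′ i j i′ j′} → i ≢ j →
                          base c i G.∙ t ≡ base c′ i′ G.∙ t′ → base c j G.∙ t ≡ base c′ j′ G.∙ t′ →
                          (c , t) ≡ (c′ , t′)
      translates-unique {c} {c′} {t} {t′} {i} {j} {i′} {j′} i≢j eqᵢ eqⱼ
        with refl ← unique (c , i , j) (c′ , i′ , j′)
                      (λ eq → i≢j (transversal c i j (K.x∙y⁻¹≈ε⇒x≈y _ _ eq)))
                      refl (same-difference {c} {c′} eqᵢ eqⱼ)
        = cong (c ,_) (G.∙-cancelˡ (base c i) t t′ eqᵢ)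

      fibre-component : ∀ y p {g} → fibre y p ≡ inj₂ g → y ≡ proj₂ g
      fibre-component y (inj₂ _) refl = refl

      -- The finite points of a fibre share one K-component, whereas a translate takes each
      -- K-component at most once.
      translate-not-fibre : ∀ {c t i j} → i ≢ j → ∀ y p q →
                            fibre y p ≡ inj₂ (base c i G.∙ t) → fibre y q ≢ inj₂ (base c j G.∙ t)
      translate-not-fibre {c} {t} i≢j y p q eqᵢ eqⱼ =
        i≢j (same-component c t (trans (sym (fibre-component y p eqᵢ)) (fibre-component y q eqⱼ)))

      -- Of two distinct points at most one is at infinity; the other reveals the fibre.
      same-fibre : ∀ {y y′} p q p′ q′ → p ≢ q →
                   fibre y p ≡ fibre y′ p′ → fibre y q ≡ fibre y′ q′ → y ≡ y′
      same-fibre (inj₁ a) (inj₁ b) _ _ p≢q _ _ = contradiction (cong inj₁ (W-prop a b)) p≢q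
      same-fibre (inj₁ _) (inj₂ _) _ (inj₂ _) _ _ eq = cong proj₂ (inj₂-injective eq)
      same-fibre (inj₂ _) _ (inj₂ _) _ _ eq _ = cong proj₂ (inj₂-injective eq)

      join-unique′ : ∀ l l′ {i j i′ j′} → i ≢ j →
                     point l i ≡ point l′ i′ → point l j ≡ point l′ j′ → l ≡ l′
      join-unique′ (inj₁ _) (inj₁ _) i≢j eqᵢ eqⱼ =
        cong inj₁ (translates-unique i≢j (inj₂-injective eqᵢ) (inj₂-injective eqⱼ))
      join-unique′ (inj₁ _) (inj₂ (l , y)) i≢j eqᵢ eqⱼ =
        contradiction (sym eqⱼ) (translate-not-fibre i≢j y (S.point l _) (S.point l _) (sym eqᵢ))
      join-unique′ (inj₂ (l , y)) (inj₁ _) i≢j eqᵢ eqⱼ =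
        contradiction eqⱼ (translate-not-fibre i′≢j′ y (S.point l _) (S.point l _) eqᵢ)
        where
        i′≢j′ : _ ≢ _
        i′≢j′ refl = i≢j (point-injective (inj₂ (l , y)) (trans eqᵢ (sym eqⱼ)))
      join-unique′ (inj₂ (l , y)) (inj₂ (l′ , y′)) {i} {j} {i′} {j′} i≢j eqᵢ eqⱼ
        with refl ← same-fibre {y} {y′} (S.point l i) (S.point l j) (S.point l′ i′) (S.point l′ j′)
                      (i≢j ∘ S.point-injective l) eqᵢ eqⱼ
        = cong (λ l → inj₂ (l , y)) (S.join-unique (i≢j ∘ S.point-injective l)
            (i , refl) (j , refl)
            (i′ , sym (fibre-injective y eqᵢ)) (j′ , sym (fibre-injective y eqⱼ)))

    development : LinearSpace Point k
    development = record
      { Line            = Line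
      ; finite          = finite-⊎ (finite-× ↔-refl G.finite) (finite-× S.finite K.finite)
      ; point           = point
      ; point-injective = point-injective
      ; join            = join
      ; join-unique     = λ { {l = l} {m = m} p≢q (_ , refl) (_ , refl) (_ , eq₁) (_ , eq₂) →
                              join-unique′ l m (p≢q ∘ cong (point l)) (sym eq₁) (sym eq₂) }
      }

    design : Design2 (w + H.order * K.order) k 1
    design = toDesign (transport (finite-⊎ W-finite G.finite) development)

-- Laws checked by evaluation: the fields of orders 8 and 9.

-- Unlike toWitness or from-yes applied to a closed decision, this lets Agda evaluate the
-- decision a single time.
witness : {P : Set} (P? : Dec P) → does P? ≡ true → P
witness (yes p) _ = p

divisionLaws? : (G : FiniteGroup) → let open FiniteGroup G in (_·_ _/_ : Carrier → Carrier → Carrier) →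
  Dec ((∀ m x y → m · (x // y) ≡ (m · x) // (m · y)) ×
       (∀ y x → x ≡ ε ⊎ (y / x) · x ≡ y) ×
       (∀ m x → x ≡ ε ⊎ (m · x) / x ≡ m))
divisionLaws? G _·_ _/_ =
  (all-elements? λ m → all-elements? λ x → all-elements? λ y → m · (x // y) ≟ (m · x) // (m · y)) ×-dec
  (all-elements? λ y → all-elements? λ x → (x ≟ ε) ⊎-dec ((y / x) · x ≟ y)) ×-dec
  (all-elements? λ m → all-elements? λ x → (x ≟ ε) ⊎-dec ((m · x) / x ≟ m))
  where
  open FiniteGroup G
  all-elements? : {P : Carrier → Set} → Decidable P → Dec (∀ x → P x)
  all-elements? = finite-all? finite

-- power _·_ x n is the (n + 1)-st power, so that in a field of order q the inverse of x
-- is power _·_ x (q - 3).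
power : {A : Set} → (A → A → A) → A → ℕ → A
power _·_ x zero    = x
power _·_ x (suc n) = x · power _·_ x n

𝔽₈⁺ : FiniteGroup
𝔽₈⁺ = ℤ/ 2 ×ᴳ ℤ/ 2 ×ᴳ ℤ/ 2

-- 𝔽₈ = 𝔽₂[t] / (t³ + t + 1), with (a , b , c) standing for a + b t + c t².
𝔽₈ : Division 𝔽₈⁺
𝔽₈ = record
  { _·_       = _·₈_
  ; _/_       = _/₈_
  ; ·-distrib = proj₁ laws
  ; /-·       = proj₁ (proj₂ laws)
  ; ·-/       = proj₂ (proj₂ laws)
  }
  where
  open FiniteGroup 𝔽₈⁺ using (Carrier)
  _·₈_ _/₈_ : Carrier → Carrier → Carrier
  (a , b , c) ·₈ (a′ , b′ , c′) =
    fromℕ₂ (toℕ a * toℕ a′ + t³) ,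
    fromℕ₂ (toℕ a * toℕ b′ + toℕ b * toℕ a′ + t³ + t⁴) ,
    fromℕ₂ (toℕ a * toℕ c′ + toℕ b * toℕ b′ + toℕ c * toℕ a′ + t⁴)
    where
    fromℕ₂ : ℕ → Fin 2
    fromℕ₂ m = m mod 2
    t³ t⁴ : ℕ
    t³ = toℕ b * toℕ c′ + toℕ c * toℕ b′
    t⁴ = toℕ c * toℕ c′
  x /₈ y = x ·₈ power _·₈_ y 5
  laws = witness (divisionLaws? 𝔽₈⁺ _·₈_ _/₈_) refl

𝔽₉⁺ : FiniteGroup
𝔽₉⁺ = ℤ/ 3 ×ᴳ ℤ/ 3

-- 𝔽₉ = 𝔽₃[i], with (a , b) standing for a + b i; the factor 2 is - 1 = i².
𝔽₉ : Division 𝔽₉⁺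
𝔽₉ = record
  { _·_       = _·₉_
  ; _/_       = _/₉_
  ; ·-distrib = proj₁ laws
  ; /-·       = proj₁ (proj₂ laws)
  ; ·-/       = proj₂ (proj₂ laws)
  }
  where
  open FiniteGroup 𝔽₉⁺ using (Carrier)
  _·₉_ _/₉_ : Carrier → Carrier → Carrier
  (a , b) ·₉ (a′ , b′) =
    (toℕ a * toℕ a′ + 2 * (toℕ b * toℕ b′)) mod 3 , (toℕ a * toℕ b′ + toℕ b * toℕ a′) mod 3
  x /₉ y = x ·₉ power _·₉_ y 6
  laws = witness (divisionLaws? 𝔽₉⁺ _·₉_ _/₉_) refl

-- The action of σ and the base blocks.

𝔽₂₅⁺ : FiniteGroup
𝔽₂₅⁺ = ℤ/ 5 ×ᴳ ℤ/ 5

module _ (n : ℕ) .{{_ : NonZero n}} where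
  private
    module H = FiniteGroup (ℤ/ n)
    module F = FiniteGroup (ℤ/ 5)

  Element : Set
  Element = H.Carrier × FiniteGroup.Carrier 𝔽₂₅⁺

  element : ℕ × ℕ × ℕ → Element
  element (h , a , b) = h mod n , a mod 5 , b mod 5

  -- Multiplication by τ in the basis (1 , τ), where τ² = 1 + 2 τ.
  σ : Element → Element
  σ (h , a , b) = h H.⁻¹ , b , a F.∙ (b F.∙ b)

  -- Since τ³ = 2, the map σ³ sends (h , x) to (- h , 2 x) and has order 4. A block made of
  -- σ³-orbits is invariant under σ³, which is why the first starter has only 3 images under σ.
  σ³-orbit : ℕ × ℕ × ℕ → Vec Element 4
  σ³-orbit p = iterate (σ ∘ σ ∘ σ) (element p) 4

  -- The number 27 = 3 + 12 + 12 agrees with the count of differences: 27 · 8 · 7 = 63 · 24 and 27 ·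
  -- 9 · 8 = 81 · 24, with 24 the number of nonzero elements of 𝔽₂₅.
  develop : ∀ {k} → Vec Element k → Vec (ℕ × ℕ × ℕ) k → Vec (ℕ × ℕ × ℕ) k → Fin 27 → Fin k → Element
  develop A B C c i = lookup (lookup (orbit A 3 ++ orbit (Vec.map element B) 12 ++ orbit (Vec.map element C) 12) c) i
    where
    orbit : ∀ {k} → Vec Element k → ∀ m → Vec (Vec Element k) m
    orbit = iterate (Vec.map σ)

base₆₃ : Fin 27 → Fin 8 → Element 63
base₆₃ = develop 63
  (σ³-orbit 63 (20 , 0 , 1) ++ σ³-orbit 63 (29 , 1 , 3))
  ((0 , 0 , 0) ∷ (1 , 0 , 4) ∷ (3 , 4 , 3) ∷ (7 , 0 , 1) ∷
   (19 , 0 , 3) ∷ (34 , 2 , 2) ∷ (42 , 2 , 0) ∷ (53 , 1 , 3) ∷ [])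
  ((0 , 0 , 0) ∷ (1 , 4 , 4) ∷ (4 , 1 , 2) ∷ (6 , 1 , 4) ∷
   (26 , 3 , 2) ∷ (36 , 0 , 2) ∷ (43 , 1 , 0) ∷ (51 , 2 , 3) ∷ [])

base₈₁ : Fin 27 → Fin 9 → Element 81
base₈₁ = develop 81
  -- The origin is fixed by σ and supplies the odd point in 9 = 1 + 4 + 4.
  (element 81 (0 , 0 , 0) ∷ σ³-orbit 81 (4 , 0 , 1) ++ σ³-orbit 81 (37 , 1 , 3))
  ((0 , 0 , 0) ∷ (1 , 0 , 4) ∷ (4 , 2 , 1) ∷ (6 , 0 , 1) ∷ (17 , 0 , 3) ∷
   (18 , 1 , 2) ∷ (38 , 4 , 2) ∷ (63 , 3 , 4) ∷ (72 , 4 , 0) ∷ [])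
  ((0 , 0 , 0) ∷ (2 , 3 , 4) ∷ (7 , 2 , 0) ∷ (27 , 3 , 1) ∷ (30 , 0 , 1) ∷
   (38 , 1 , 0) ∷ (53 , 1 , 2) ∷ (59 , 3 , 0) ∷ (69 , 0 , 4) ∷ [])

-- Verification of the families and assembly of the designs.

open RelativeDifferenceFamily

base₆₃-isDifferenceFamily : IsDifferenceFamily (ℤ/ 63) 𝔽₂₅⁺ base₆₃
base₆₃-isDifferenceFamily = witness (isDifferenceFamily? (ℤ/ 63) 𝔽₂₅⁺ base₆₃) refl

base₈₁-isDifferenceFamily : IsDifferenceFamily (ℤ/ 81) 𝔽₂₅⁺ base₈₁
base₈₁-isDifferenceFamily = witness (isDifferenceFamily? (ℤ/ 81) 𝔽₂₅⁺ base₈₁) refl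

theorem2p17 : Design2 1576 8 1 × Design2 2025 9 1
theorem2p17 =
  -- 1576 = 1 + 63 · 25. The points of the plane of order 8 are numbered arbitrarily, and the one
  -- numbered 0 becomes the point at infinity.
  Development.design (ℤ/ 63) 𝔽₂₅⁺ base₆₃ base₆₃-isDifferenceFamily ↔-refl (λ { zero zero → refl })
    (transport (↔-trans (finite-× finite₈ finite₈) (+↔⊎ {1} {63})) (AffinePlane.affinePlane 𝔽₈⁺ 𝔽₈)) ,
  -- 2025 = 81 · 25. Here `W` is `Fin 0`: the 81 points of the plane of order 9 fill a coset
  -- exactly.
  Development.design (ℤ/ 81) 𝔽₂₅⁺ base₈₁ base₈₁-isDifferenceFamily ↔-refl (λ ())
    (transport (↔-trans (finite-× finite₉ finite₉) (+↔⊎ {0} {81})) (AffinePlane.affinePlane 𝔽₉⁺ 𝔽₉))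
  where
  open FiniteGroup 𝔽₈⁺ renaming (finite to finite₈)
  open FiniteGroup 𝔽₉⁺ renaming (finite to finite₉)
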